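{- Let $a\in\mathbb N^n$ be a weak composition and $1\le i<n$. For every $T\in\mathrm{SSKD}(a)$ with $e_i(T)\ne0$, we have $e_i(T)\in\mathrm{SSKD}(a)$ and $\mathrm{maj}(e_i(T))=\mathrm{maj}(T)$. That is, $e_i:\mathrm{SSKD}(a)\to\mathrm{SSKD}(a)\cup\{0\}$ is a well-defined $\mathrm{maj}$-preserving map.
   Context: The diagram of $a$ has cells $(r,c)$ (row $r$ from the bottom, column $c$ from the left) with $1\le c\le a_r$, augmented (following Haglund–Haiman–Loehr) by a basement column $0$ whose cell $(r,0)$ contains $r$, basement cells being included in the conditions below (row lengths compared without basement). Fillings have entries in $\{1,\dots,n\}$. Cells attack if in the same column, or in adjacent columns with the left cell strictly higher; non-attacking: attacking cells have different entries. A triple: cells $(r,c),(r,c+1)$ with entries $i,j$ and a third with entry $k$, either $(s,c)$, $s>r$, row $r$ strictly longer than row $s$ (Type I), or $(s,c+1)$, $s<r$, row $r$ weakly longer than row $s$ (Type II); co-inversion if $i<j<k$, $j<k<i$ or $k<i<j$. $\mathrm{SSKD}(a)$: non-attacking fillings with no co-inversion triples. $\mathrm{maj}(T)=\sum(a_r-c)$ over cells $(r,c)$ with $(r,c+1)$ in the diagram and $T(r,c)<T(r,c+1)$. $i$-pairing: pair an $i$ and an $i+1$ in the same column, then iteratively pair an unpaired $i+1$ with an unpaired $i$ to its left whenever all entries $i,i+1$ between them are paired. Raising $e_i$: $e_i(T)=0$ if $T$ has no unpaired $i+1$; otherwise change the rightmost unpaired $i+1$ to $i$, swap $i,i+1$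 in each of the consecutive columns immediately to its left having an $i+1$ in the same row and an $i$ above, and in each of the consecutive columns immediately to its right having an $i+1$ in the same row and an $i$ below. -}

module Defs where

open import Data.Nat using (ℕ; zero; suc; _+_; _∸_; _≤_; _<_; _⊔_; _≤ᵇ_; _<ᵇ_; _≡ᵇ_)
open import Data.Bool using (Bool; true; false; _∧_; if_then_else_)
open import Data.Maybe using (Maybe; just; nothing)
open import Data.List using (List; []; _∷_; map; upTo)
open import Data.Nat.ListAction using (sum)
open import Data.Vec using (Vec; []; _∷_; foldr)
open import Data.Product using (_×_; _,_)
open import Data.Sum using (_⊎_)
open import Relation.Nullary using (¬_)
open import Relation.Binary.PropositionalEquality using (_≢_)

-- Conventions.
-- A weak composition a ∈ ℕ^n is a vector  a : Vec ℕ n ; row r (1 ≤ r ≤ n,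
-- counted from the bottom) has length a_r = rowLen a r.  Rows and columns
-- are 1-indexed natural numbers; column 0 is the basement.
-- A filling is a function  T : ℕ → ℕ → ℕ ,  T r c  the entry of cell (r,c);
-- only its values on cells of the diagram matter.

rowLen : ∀ {n} → Vec ℕ n → ℕ → ℕ
rowLen []       _             = 0
rowLen (x ∷ xs) zero          = 0
rowLen (x ∷ xs) (suc zero)    = x
rowLen (x ∷ xs) (suc (suc r)) = rowLen xs (suc r)

maxLen : ∀ {n} → Vec ℕ n → ℕ
maxLen = foldr _ _⊔_ 0

Filling : Set
Filling = ℕ → ℕ → ℕ

InDiag : ∀ {n} → Vec ℕ n → ℕ → ℕ → Set
InDiag {n} a r c = 1 ≤ r × r ≤ n × 1 ≤ c × c ≤ rowLen a r

InExt : ∀ {n} → Vec ℕ n → ℕ → ℕ → Set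
InExt {n} a r c = 1 ≤ r × r ≤ n × c ≤ rowLen a r

val : Filling → ℕ → ℕ → ℕ
val T r zero    = r
val T r (suc c) = T r (suc c)

Entries : ∀ {n} → Vec ℕ n → Filling → Set
Entries {n} a T = ∀ r c → InDiag a r c → 1 ≤ T r c × T r c ≤ n

NonAttacking : ∀ {n} → Vec ℕ n → Filling → Set
NonAttacking a T =
  (∀ r s c → InExt a r c → InExt a s c → r ≢ s → val T r c ≢ val T s c) ×
  (∀ r s c → InExt a r c → InExt a s (suc c) → s < r →
     val T r c ≢ val T s (suc c))

CoInv : ℕ → ℕ → ℕ → Set
CoInv i j k = (i < j × j < k) ⊎ (j < k × k < i) ⊎ (k < i × i < j)

NoCoinvTriples : ∀ {n} → Vec ℕ n → Filling → Set
NoCoinvTriples a T =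
  (∀ r s c → InExt a r c → InExt a r (suc c) → InExt a s c → r < s →
     rowLen a s < rowLen a r →
     ¬ CoInv (val T r c) (val T r (suc c)) (val T s c)) ×
  (∀ r s c → InExt a r c → InExt a r (suc c) → InExt a s (suc c) → s < r →
     rowLen a s ≤ rowLen a r →
     ¬ CoInv (val T r c) (val T r (suc c)) (val T s (suc c)))

SSKD : ∀ {n} → Vec ℕ n → Filling → Set
SSKD a T = Entries a T × NonAttacking a T × NoCoinvTriples a T

maj : ∀ {n} → Vec ℕ n → Filling → ℕ
maj {n} a T = sum (map rowMaj (map suc (upTo n)))
  where
  rowMaj : ℕ → ℕ
  rowMaj r = sum (map (λ c → if T r c <ᵇ T r (suc c) then rowLen a r ∸ c else 0)
                      (map suc (upTo (rowLen a r ∸ 1))))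

inDiagᵇ : ∀ {n} → Vec ℕ n → ℕ → ℕ → Bool
inDiagᵇ {n} a r c = (1 ≤ᵇ r) ∧ (r ≤ᵇ n) ∧ (1 ≤ᵇ c) ∧ (c ≤ᵇ rowLen a r)

findFirst : (ℕ → Bool) → List ℕ → Maybe ℕ
findFirst p []       = nothing
findFirst p (x ∷ xs) = if p x then just x else findFirst p xs

isJust : {A : Set} → Maybe A → Bool
isJust (just _) = true
isJust nothing  = false

rowWith : ∀ {n} → Vec ℕ n → Filling → ℕ → ℕ → Maybe ℕ
rowWith {n} a T c v = findFirst (λ s → inDiagᵇ a s c ∧ (T s c ≡ᵇ v)) (map suc (upTo n))

rowAbove rowBelow : ∀ {n} → Vec ℕ n → Filling → ℕ → ℕ → ℕ → Maybe ℕ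
rowAbove {n} a T r c v =
  findFirst (λ s → (r <ᵇ s) ∧ inDiagᵇ a s c ∧ (T s c ≡ᵇ v)) (map suc (upTo n))
rowBelow {n} a T r c v =
  findFirst (λ s → (s <ᵇ r) ∧ inDiagᵇ a s c ∧ (T s c ≡ᵇ v)) (map suc (upTo n))

-- i-pairing.  After pairing the i and i+1 lying in a common column, each
-- column carries at most one unpaired candidate: an i (an "opener") or an
-- i+1 (a "closer").  Iteratively pairing an unpaired i+1 with an unpaired i
-- to its left with only paired i, i+1 in between is bracket matching of
-- the column word read left to right.
data Sym : Set where
  opener closer neutral : Sym

colSym : ∀ {n} → Vec ℕ n → Filling → ℕ → ℕ → Sym
colSym a T i c with isJust (rowWith a T c i) | isJust (rowWith a T c (suc i))
... | true  | false = opener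
... | false | true  = closer
... | _     | _     = neutral

-- scan columns left to right with k = number of currently unpaired i's;
-- returns the rightmost column holding an unpaired i+1
scan : ℕ → Maybe ℕ → List (ℕ × Sym) → Maybe ℕ
scan k       best []                  = best
scan k       best ((c , opener) ∷ xs)  = scan (suc k) best xs
scan zero    best ((c , closer) ∷ xs)  = scan zero (just c) xs
scan (suc k) best ((c , closer) ∷ xs)  = scan k best xs
scan k       best ((c , neutral) ∷ xs) = scan k best xs

rightmostUnpaired : ∀ {n} → Vec ℕ n → Filling → ℕ → Maybe ℕ
rightmostUnpaired a T i =
  scan 0 nothing (map (λ c → (c , colSym a T i c)) (map suc (upTo (maxLen a))))

module Raise {n : ℕ} (a : Vec ℕ n) (T : Filling) (i : ℕ) (r c : ℕ) where
  -- (r,c): the cell of the rightmost unpaired i+1.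
  -- column d qualifies on the left: i+1 in row r and an i above (row s)
  condL : ℕ → Maybe ℕ
  condL d = if inDiagᵇ a r d ∧ (T r d ≡ᵇ suc i) then rowAbove a T r d i else nothing
  condR : ℕ → Maybe ℕ
  condR d = if inDiagᵇ a r d ∧ (T r d ≡ᵇ suc i) then rowBelow a T r d i else nothing

  leftLen : ℕ → ℕ
  leftLen zero    = 0
  leftLen (suc d) = if isJust (condL (suc d)) then suc (leftLen d) else 0

  rightLen : ℕ → ℕ → ℕ
  rightLen zero       d = 0
  rightLen (suc fuel) d = if isJust (condR d) then suc (rightLen fuel (suc d)) else 0

  L R : ℕ
  L = leftLen (c ∸ 1)
  R = rightLen (maxLen a) (suc c)

  swapAt : Maybe ℕ → ℕ → ℕ → ℕ
  swapAt (just s) r' d = if r' ≡ᵇ r then i else if r' ≡ᵇ s then suc i else T r' d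
  swapAt nothing  r' d = T r' d

  result : Filling
  result r' d =
    if d ≡ᵇ c then (if r' ≡ᵇ r then i else T r' d)
    else if (d <ᵇ c) ∧ ((c ∸ d) ≤ᵇ L) then swapAt (condL d) r' d
    else if (c <ᵇ d) ∧ ((d ∸ c) ≤ᵇ R) then swapAt (condR d) r' d
    else T r' d

-- e_i(T); nothing represents 0
raise : ∀ {n} → Vec ℕ n → ℕ → Filling → Maybe Filling
raise a i T with rightmostUnpaired a T i
... | nothing = nothing
... | just c with rowWith a T c (suc i)
...   | nothing = nothing
...   | just r  = just (Raise.result a T i r c)

{-# OPTIONS --safe #-}
module Submission where

-- Raising exchanges i and i+1 in a run of consecutive columns lo, …, hi, and every condition
-- concerns two adjacent columns, so only pairs meeting the run need attention.  A triple can
-- become a co-inversion only through two entries in {i, i+1}; inside the run this is excluded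
-- by comparing row lengths: the i above row r left of the centre lies in a shorter row, because
-- otherwise the triple conditions would extend it to the left, with an i+1 below it (no i being
-- unpaired there), down to the basement, where i+1 is above i.  The i below row r right of the
-- centre lies in a row of length at most that of r, since otherwise it would extend to the left
-- into the centre.  At the left end of the run an i in column lo−1 has its partner above it and
-- weakly below row r.  At the right end, an i+1 of column hi+1 in row r with an i above it
-- would repeat in all later columns, beyond the end of row r.

open import Defs
open import Data.Nat using (ℕ; zero; suc; pred; _+_; _∸_; _≤_; _<_; _≟_;
  _≤?_; _<?_; z≤n; s≤s; s≤s⁻¹; _≡ᵇ_)
open import Data.Nat.Properties
open import Data.Nat.ListAction using (sum)
open import Data.Bool using (true; false; if_then_else_)
open import Data.Vec using (Vec; []; _∷_)
open import Data.List using (List; []; _∷_; map; upTo; applyUpTo)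
open import Data.List.Properties using (map-cong-local)
open import Data.List.Relation.Unary.All as All using (All; []; _∷_)
import Data.List.Relation.Unary.All.Properties as All
open import Data.Maybe using (Maybe; just; nothing)
open import Data.Product using (_×_; _,_; proj₁; proj₂; ∃)
open import Data.Sum using (_⊎_; inj₁; inj₂; [_,_]′)
open import Data.Unit using (⊤; tt)
open import Data.Empty using (⊥)
open import Function using (_∘_)
open import Function.Bundles using (mk⇔)
open import Relation.Nullary using (¬_; Dec; does; yes; no; contradiction)
open import Relation.Nullary.Decidable using (_×-dec_; does-⇔)
open import Relation.Binary.Definitions using (tri<; tri≈; tri>)
open import Relation.Binary.PropositionalEquality using (_≡_; _≢_; refl; sym; trans; cong; cong₂; subst; subst₂)

-- Comparisons and co-inversions under exchange of i and i+1.

Mid : ℕ → ℕ → Set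
Mid i v = v ≡ i ⊎ v ≡ suc i

mid? : ∀ i v → Dec (Mid i v)
mid? i v with v ≟ i | v ≟ suc i
... | yes p | _     = yes (inj₁ p)
... | no _  | yes q = yes (inj₂ q)
... | no p  | no q  = no [ p , q ]′

below-mid : ∀ {i v w} → ¬ Mid i v → Mid i w → v < w → v < i
below-mid _  (inj₁ refl) v<w = v<w
below-mid ¬m (inj₂ refl) v<w = ≤∧≢⇒< (s≤s⁻¹ v<w) (¬m ∘ inj₁)

above-mid : ∀ {i v w} → ¬ Mid i v → Mid i w → w < v → suc i < v
above-mid ¬m (inj₁ refl) w<v = ≤∧≢⇒< w<v (¬m ∘ inj₂ ∘ sym)
above-mid _  (inj₂ refl) w<v = w<v

mid-lower : ∀ {i v} → Mid i v → i ≤ v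
mid-lower (inj₁ refl) = ≤-refl
mid-lower (inj₂ refl) = n≤1+n _

mid-upper : ∀ {i v} → Mid i v → v ≤ suc i
mid-upper (inj₁ refl) = n≤1+n _
mid-upper (inj₂ refl) = ≤-refl

mid-< : ∀ {i v w} → Mid i v → Mid i w → v < w → v ≡ i × w ≡ suc i
mid-< (inj₁ p)    (inj₂ q)    _   = p , q
mid-< (inj₁ refl) (inj₁ refl) v<w = contradiction v<w (<-irrefl refl)
mid-< (inj₂ refl) (inj₁ refl) v<w = contradiction v<w (<⇒≱ (n<1+n _) ∘ <⇒≤)
mid-< (inj₂ refl) (inj₂ refl) v<w = contradiction v<w (<-irrefl refl)

-- The transposition (i i+1), as a relation.
data Swap (i : ℕ) : ℕ → ℕ → Set where
  up   : Swap i i (suc i)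
  down : Swap i (suc i) i
  fix  : ∀ {v} → ¬ Mid i v → Swap i v v

swap-from-i : ∀ {i v v′} → Swap i v v′ → v′ ≡ i → v ≡ suc i
swap-from-i down    _    = refl
swap-from-i up      e    = contradiction e 1+n≢n
swap-from-i (fix ¬m) e   = contradiction (inj₁ e) ¬m

swap-from-1+i : ∀ {i v v′} → Swap i v v′ → v′ ≡ suc i → v ≡ i
swap-from-1+i up       _ = refl
swap-from-1+i down     e = contradiction (sym e) 1+n≢n
swap-from-1+i (fix ¬m) e = contradiction (inj₂ e) ¬m

swap-outside : ∀ {i v v′} → Swap i v v′ → ¬ Mid i v′ → v ≡ v′
swap-outside up      ¬m = contradiction (inj₂ refl) ¬m
swap-outside down    ¬m = contradiction (inj₁ refl) ¬m
swap-outside (fix _) _  = refl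

-- Coarser than `Swap`: it also relates an entry to itself inside {i, i+1}. Thus it holds in every
-- column, altered or not, and a pair of columns with only one altered needs no separate treatment.
data Sim (i : ℕ) : ℕ → ℕ → Set where
  outside : ∀ {v} → ¬ Mid i v → Sim i v v
  inside  : ∀ {v v′} → Mid i v → Mid i v′ → Sim i v v′

swap-sim : ∀ {i v v′} → Swap i v v′ → Sim i v v′
swap-sim up       = inside (inj₁ refl) (inj₂ refl)
swap-sim down     = inside (inj₂ refl) (inj₁ refl)
swap-sim (fix ¬m) = outside ¬m

≡-sim : ∀ {i v v′} → v′ ≡ v → Sim i v v′
≡-sim {i} {v} refl with mid? i v
... | yes m = inside m m
... | no ¬m = outside ¬m

-- A value outside {i, i+1} compares alike with i and with i+1, so a comparison can change only
-- between two members of the pair.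
sim-< : ∀ {i p q p′ q′} → Sim i p p′ → Sim i q q′ →
        p′ < q′ → p < q ⊎ (p′ ≡ i × q′ ≡ suc i)
sim-< (outside _)  (outside _)  l = inj₁ l
sim-< (outside ¬p) (inside q q′) l = inj₁ (<-≤-trans (below-mid ¬p q′ l) (mid-lower q))
sim-< (inside p p′) (outside ¬q) l = inj₁ (≤-<-trans (mid-upper p) (above-mid ¬q p′ l))
sim-< (inside _ p′) (inside _ q′) l = inj₂ (mid-< p′ q′ l)

sim-mid : ∀ {i v v′} → Sim i v v′ → Mid i v → Mid i v′
sim-mid (outside _)   m = m
sim-mid (inside _ m′) _ = m′

sim-sym : ∀ {i v v′} → Sim i v v′ → Sim i v′ v
sim-sym (outside ¬m)  = outside ¬m
sim-sym (inside m m′) = inside m′ m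

sim-bounds : ∀ {i n v v′} → 1 ≤ i → i < n → Sim i v v′ → 1 ≤ v × v ≤ n → 1 ≤ v′ × v′ ≤ n
sim-bounds _   _   (outside _)  b = b
sim-bounds 1≤i i<n (inside _ m) _ = ≤-trans 1≤i (mid-lower m) , ≤-trans (mid-upper m) i<n

-- With p, q, k the entries of a triple, primed after raising: the cyclic order can only
-- change when two of the three entries lie in {i, i+1}, which leaves one case per pair.
data CreatedCoInv (i p p′ q q′ k k′ : ℕ) : Set where
  old     : CoInv p q k → CreatedCoInv i p p′ q q′ k k′
  at-pq   : p′ ≡ i → q′ ≡ suc i → CreatedCoInv i p p′ q q′ k k′
  at-qk   : q′ ≡ i → k′ ≡ suc i → ¬ Mid i p → CreatedCoInv i p p′ q q′ k k′
  at-kp   : k′ ≡ i → p′ ≡ suc i → CreatedCoInv i p p′ q q′ k k′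

created : ∀ {i p p′ q q′ k k′} → Sim i p p′ → Sim i q q′ → Sim i k k′ →
          CoInv p′ q′ k′ → CreatedCoInv i p p′ q q′ k k′
created P Q K (inj₁ (pq , qk)) with sim-< P Q pq | sim-< Q K qk
... | inj₂ (a , b) | _            = at-pq a b
... | inj₁ x       | inj₁ y       = old (inj₁ (x , y))
... | inj₁ _       | inj₂ (b , c) =
  -- A p in {i, i+1} would give p′ ≥ i, whereas the other inequality reads p′ < i.
  at-qk b c λ m → <⇒≱ (subst (_ <_) b pq) (mid-lower (sim-mid P m))
created P Q K (inj₂ (inj₁ (qk , kp))) with sim-< Q K qk | sim-< K P kp
... | _            | inj₂ (a , b) = at-kp a b
... | inj₁ x       | inj₁ y       = old (inj₂ (inj₁ (x , y)))
... | inj₂ (b , c) | inj₁ _       =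
  at-qk b c λ m → <⇒≱ (subst (_< _) c kp) (mid-upper (sim-mid P m))
created P Q K (inj₂ (inj₂ (kp , pq))) with sim-< K P kp | sim-< P Q pq
... | inj₂ (a , b) | _            = at-kp a b
... | inj₁ _       | inj₂ (b , c) = at-pq b c
... | inj₁ x       | inj₁ y       = old (inj₂ (inj₂ (x , y)))

-- No integer lies strictly between i and i+1, so an outside value is below both or above both, and
-- both positions give the same cyclic order. With `coinv-around`, this is the forbidden triple that
-- forces an unknown entry into {i, i+1}.
coinv-step : ∀ {i p} → ¬ Mid i p → CoInv p i (suc i)
coinv-step {i} {p} ¬m with <-cmp p i
... | tri< p<i _ _ = inj₁ (p<i , n<1+n i)
... | tri≈ _ e _   = contradiction (inj₁ e) ¬m
... | tri> _ _ i<p = inj₂ (inj₁ (n<1+n i , above-mid ¬m (inj₁ refl) i<p))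

coinv-around : ∀ {i q} → ¬ Mid i q → CoInv (suc i) q i
coinv-around {i} {q} ¬m with <-cmp q i
... | tri< q<i _ _ = inj₂ (inj₁ (q<i , n<1+n i))
... | tri≈ _ e _   = contradiction (inj₁ e) ¬m
... | tri> _ _ i<q = inj₂ (inj₂ (n<1+n i , above-mid ¬m (inj₁ refl) i<q))

mid-of : ∀ {i v} → ¬ ¬ Mid i v → Mid i v
mid-of {i} {v} ¬¬m with mid? i v
... | yes m = m
... | no ¬m = contradiction ¬m ¬¬m

-- Local consequences of the non-attacking and triple conditions.

Has : ∀ {n} → Vec ℕ n → Filling → ℕ → ℕ → ℕ → Set
Has a T v d x = InExt a x d × val T x d ≡ v

module Columns {n : ℕ} (a : Vec ℕ n) (T : Filling) (H : SSKD a T) where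

  len : ℕ → ℕ
  len = rowLen a

  InExt-left : ∀ {x d} → InExt a x (suc d) → InExt a x d
  InExt-left (p , q , l) = p , q , ≤-trans (n≤1+n _) l

  unique : ∀ {v d x y} → Has a T v d x → Has a T v d y → x ≡ y
  unique {v} {d} {x} {y} (X , ex) (Y , ey) with x ≟ y
  ... | yes e = e
  ... | no ne = contradiction (trans ex (sym ey)) (proj₁ (proj₁ (proj₂ H)) x y d X Y ne)

  ascending : ∀ {v d x y} → Has a T v d x → Has a T v (suc d) y → x ≤ y
  ascending {v} {d} {x} {y} (X , ex) (Y , ey) with x ≤? y
  ... | yes p = p
  ... | no ¬p = contradiction (trans ex (sym ey)) (proj₂ (proj₁ (proj₂ H)) x y d X Y (≰⇒> ¬p))

  module _ {i d r s : ℕ} where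

    -- An entry outside {i, i+1} at the unknown cell would make a co-inversion triple. Of the two
    -- remaining values, one is excluded because the same value already stands in an attacking cell.
    -- The next three lemmas follow this pattern, with `unique` or `ascending` as the non-attacking
    -- condition.
    1+i-continues-I : Has a T (suc i) d r → Has a T i d s → r < s → len s < len r →
                      suc d ≤ len r → Has a T (suc i) (suc d) r
    1+i-continues-I (R@(p , q , _) , er) (S , es) r<s ls l =
      with-mid (mid-of λ ¬m → proj₁ (proj₂ (proj₂ H)) r s d R R⁺ S r<s ls
        (subst₂ (λ u v → CoInv u (T r (suc d)) v) (sym er) (sym es) (coinv-around ¬m)))
      where
      R⁺ : InExt a r (suc d)
      R⁺ = p , q , l
      with-mid : Mid i (T r (suc d)) → Has a T (suc i) (suc d) r
      with-mid (inj₁ e) = contradiction (ascending (S , es) (R⁺ , e)) (<⇒≱ r<s)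
      with-mid (inj₂ e) = R⁺ , e

    1+i-continues-II : Has a T (suc i) d r → Has a T i (suc d) s → s < r → len s ≤ len r →
                       Has a T (suc i) (suc d) r
    1+i-continues-II (R@(p , q , _) , er) (S , es) s<r ls =
      with-mid (mid-of λ ¬m → proj₂ (proj₂ (proj₂ H)) r s d R R⁺ S s<r ls
        (subst₂ (λ u v → CoInv u (T r (suc d)) v) (sym er) (sym es) (coinv-around ¬m)))
      where
      R⁺ : InExt a r (suc d)
      R⁺ = p , q , ≤-trans (proj₂ (proj₂ S)) ls
      with-mid : Mid i (T r (suc d)) → Has a T (suc i) (suc d) r
      with-mid (inj₁ e) = contradiction (unique (S , es) (R⁺ , e)) (<⇒≢ s<r)
      with-mid (inj₂ e) = R⁺ , e

    i-precedes-I : Has a T i (suc d) r → Has a T (suc i) d s → r < s → len s < len r →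
                   Has a T i d r
    i-precedes-I (R , er) (S , es) r<s ls =
      with-mid (mid-of λ ¬m → proj₁ (proj₂ (proj₂ H)) r s d (InExt-left R) R S r<s ls
        (subst₂ (λ u v → CoInv (val T r d) u v) (sym er) (sym es) (coinv-step ¬m)))
      where
      with-mid : Mid i (val T r d) → Has a T i d r
      with-mid (inj₁ e) = InExt-left R , e
      with-mid (inj₂ e) = contradiction (unique (InExt-left R , e) (S , es)) (<⇒≢ r<s)

    i-precedes-II : Has a T i (suc d) r → Has a T (suc i) (suc d) s → s < r → len s ≤ len r →
                    Has a T i d r
    i-precedes-II (R , er) (S , es) s<r ls =
      with-mid (mid-of λ ¬m → proj₂ (proj₂ (proj₂ H)) r s d (InExt-left R) R S s<r ls
        (subst₂ (λ u v → CoInv (val T r d) u v) (sym er) (sym es) (coinv-step ¬m)))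
      where
      with-mid : Mid i (val T r d) → Has a T i d r
      with-mid (inj₁ e) = InExt-left R , e
      with-mid (inj₂ e) = contradiction (ascending (InExt-left R , e) (S , es)) (<⇒≱ s<r)

-- Free d: no unpaired i is left over after reading the columns 1, …, d.
-- The interval [lo, hi] consists of the columns altered by e_i.
record IsRaising {n} (a : Vec ℕ n) (i : ℕ) (T T′ : Filling) (Free : ℕ → Set)
                 (r c lo hi : ℕ) : Set where
  field
    1≤lo : 1 ≤ lo
    lo≤c : lo ≤ c
    c≤hi : c ≤ hi
    free-before : ∀ d → suc d ≡ c → Free d
    free-at     : Free c
    free-left   : ∀ d x → Free (suc d) → Has a T i (suc d) x →
                  Free d × ∃ (Has a T (suc i) (suc d))
    free-right  : ∀ d x → c ≤ d → Free d → Has a T (suc i) (suc d) x →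
                  Free (suc d) × ∃ (Has a T i (suc d))
    centre      : Has a T (suc i) c r
    centre-no-i : ∀ x → ¬ Has a T i c x
    left        : ∀ d → lo ≤ d → d < c → Has a T (suc i) d r × ∃ λ s → Has a T i d s × r < s
    right       : ∀ d → c < d → d ≤ hi → Has a T (suc i) d r × ∃ λ s → Has a T i d s × s < r
    left-max    : ∀ d s → suc d ≡ lo → Has a T (suc i) d r → Has a T i d s → ¬ r < s
    right-max   : ∀ s → Has a T (suc i) (suc hi) r → Has a T i (suc hi) s → ¬ s < r
    swapped     : ∀ x d → InExt a x d → lo ≤ d → d ≤ hi → Swap i (val T x d) (val T′ x d)
    left-same   : ∀ x d → InExt a x d → d < lo → val T′ x d ≡ val T x d
    right-same  : ∀ x d → InExt a x d → hi < d → val T′ x d ≡ val T x d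

-- Row lengths along the run, from the abstract description of raising.

module Preservation {n} (a : Vec ℕ n) (i : ℕ) (i<n : i < n) (T T′ : Filling) (H : SSKD a T)
                    {Free : ℕ → Set} {r c lo hi : ℕ}
                    (R : IsRaising a i T T′ Free r c lo hi) where
  open IsRaising R
  open Columns a T H

  lo≤hi : lo ≤ hi
  lo≤hi = ≤-trans lo≤c c≤hi

  row-r : ∀ d → lo ≤ d → d ≤ hi → Has a T (suc i) d r
  row-r d l h with <-cmp d c
  ... | tri< d<c _ _  = proj₁ (left d l d<c)
  ... | tri≈ _ refl _ = centre
  ... | tri> _ _ c<d  = proj₁ (right d c<d h)

  -- Induction on the distance from column c-1: a run column left of the centre contains both i and
  -- i+1, so freeness passes to the column before it. The bound lo ≤ d+1 includes column lo-1, just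
  -- outside the run.
  free-run-left : ∀ k d → suc (d + k) ≡ c → lo ≤ suc d → Free d
  free-run-left zero    d e _ = free-before d (trans (cong suc (sym (+-identityʳ d))) e)
  free-run-left (suc k) d e l =
    proj₁ (free-left d s (free-run-left k (suc d) e′ (≤-trans l (n≤1+n _))) Hs)
    where
    e′ : suc (suc d + k) ≡ c
    e′ = trans (cong suc (sym (+-suc d k))) e
    run : Has a T (suc i) (suc d) r × ∃ λ s → Has a T i (suc d) s × r < s
    run = left (suc d) l (subst (suc (suc d) ≤_) e′ (s≤s (s≤s (m≤m+n d k))))
    s  = proj₁ (proj₂ run)
    Hs = proj₁ (proj₂ (proj₂ run))

  free-left-of-c : ∀ d → d < c → lo ≤ suc d → Free d
  free-left-of-c d d<c = free-run-left (c ∸ suc d) d (m+[n∸m]≡n d<c)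

  free-run-right : ∀ d → c ≤ d → d ≤ hi → Free d
  free-run-right zero    c≤d _ = subst Free (n≤0⇒n≡0 c≤d) free-at
  free-run-right (suc d) c≤d h with m≤n⇒m<n∨m≡n c≤d
  ... | inj₂ e   = subst Free e free-at
  ... | inj₁ c<d = proj₁ (free-right d r (s≤s⁻¹ c<d)
                     (free-run-right d (s≤s⁻¹ c<d) (≤-trans (n≤1+n d) h))
                     (proj₁ (right (suc d) c<d h)))

  partner : ∀ d y → Free d → Has a T i d y → ∃ (Has a T (suc i) d)
  -- The basement cell of row i+1, which exists since i < n.
  partner zero    _ _ _ = suc i , (s≤s z≤n , i<n , z≤n) , refl
  partner (suc d) y f Y = proj₂ (free-left d y f Y)

  -- If row y were at least as long as row w, the i of row y would extend left to the basement.
  free-length : ∀ d {w y} → Free d → Has a T (suc i) d w → Has a T i d y → w < y → len y < len w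
  free-length zero    _ (_ , refl) (_ , refl) w<y = contradiction w<y (<⇒≱ (n<1+n _) ∘ <⇒≤)
  free-length (suc d) {w} {y} f W Y w<y with len w ≤? len y
  ... | no ¬p = ≰⇒> ¬p
  -- The i extends to column d. By induction its partner there lies in a row w₂ longer than row y;
  -- the i+1 of that row then persists into column d+1, so w₂ is w.
  ... | yes p = subst (λ u → len y < len u) w₂≡w y<w₂
    where
    Y₀ : Has a T i d y
    Y₀ = i-precedes-II Y W w<y p
    f₀ : Free d
    f₀ = proj₁ (free-left d y f Y)
    w₂ : ℕ
    w₂ = proj₁ (partner d y f₀ Y₀)
    W₂ : Has a T (suc i) d w₂
    W₂ = proj₂ (partner d y f₀ Y₀)
    w₂<y : w₂ < y
    w₂<y = ≤-<-trans (ascending W₂ W) w<y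
    y<w₂ : len y < len w₂
    y<w₂ = free-length d f₀ W₂ Y₀ w₂<y
    w₂≡w : w₂ ≡ w
    w₂≡w = unique (1+i-continues-I W₂ Y₀ w₂<y y<w₂
             (≤-trans (proj₂ (proj₂ (proj₁ Y))) (<⇒≤ y<w₂))) W

  left-length : ∀ d {s} → lo ≤ d → d < c → Has a T i d s → r < s × len s < len r
  left-length d l d<c S with left d l d<c
  ... | R , s , S′ , r<s with unique S S′
  ... | refl = r<s , free-length d (free-left-of-c d d<c (≤-trans l (n≤1+n d))) R S r<s

  right-length : ∀ d {s} → c < d → d ≤ hi → Has a T i d s → s < r × len s ≤ len r
  right-length (suc d) c<d h S with right (suc d) c<d h
  ... | R , s , S′ , s<r with unique S S′
  ... | refl = s<r , ≮⇒≥ λ r<s → descend r<s (m≤n⇒m<n∨m≡n (s≤s⁻¹ c<d))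
    where
    descend : len r < len s → c < d ⊎ c ≡ d → ⊥
    descend r<s (inj₂ refl) = centre-no-i s (i-precedes-I S centre s<r r<s)
    descend r<s (inj₁ c<d)  = <⇒≱ r<s (proj₂ (right-length d c<d d≤hi
      (i-precedes-I S (proj₁ (right d c<d d≤hi)) s<r r<s)))
      where d≤hi = ≤-trans (n≤1+n d) h

  -- The pair (i+1 in row r, i above it in a shorter row) would be repeated in every later column.
  no-shorter-i-above : ∀ k d {y} → len r ≤ k + d → c ≤ d → Free d →
    Has a T (suc i) d r → Has a T i d y → r < y → len y < len r → ⊥
  -- `k` bounds the number of columns left in row r. At 0, column d is at or past the end of row r,
  -- out of reach of the shorter row y.
  no-shorter-i-above zero    d b _ _ _ (Y , _) _ y<r = <⇒≱ y<r (≤-trans b (proj₂ (proj₂ Y)))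
  no-shorter-i-above (suc k) d b c≤d f R Y@(Ye , _) r<y y<r =
    no-shorter-i-above k (suc d) (subst (len r ≤_) (sym (+-suc k d)) b) (≤-trans c≤d (n≤1+n d))
      (proj₁ next) R⁺ Y⁺ r<y⁺ y⁺<r
    where
    R⁺ : Has a T (suc i) (suc d) r
    R⁺ = 1+i-continues-I R Y r<y y<r (≤-<-trans (proj₂ (proj₂ Ye)) y<r)
    next : Free (suc d) × ∃ (Has a T i (suc d))
    next = free-right d r c≤d f R⁺
    y⁺ = proj₁ (proj₂ next)
    Y⁺ : Has a T i (suc d) y⁺
    Y⁺ = proj₂ (proj₂ next)
    r<y⁺ : r < y⁺
    r<y⁺ = <-≤-trans r<y (ascending Y Y⁺)
    -- Were row y⁺ at least as long as row r, its i would extend left to column d, making y⁺ the row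
    -- y, which is shorter than r.
    y⁺<r : len y⁺ < len r
    y⁺<r = ≰⇒> λ r≤y⁺ → <⇒≱ (subst (λ u → len u < len r)
             (unique Y (i-precedes-II Y⁺ R⁺ r<y⁺ r≤y⁺)) y<r) r≤y⁺

  -- Positions of i and i+1 just outside the ends of the run.

  before-1+i : ∀ d {w} → suc d ≡ lo → Has a T (suc i) d w → w ≤ r
  before-1+i d refl W = ascending W (row-r lo ≤-refl lo≤hi)

  -- If the partner were below the i, its row would be the longer one and its i+1 would persist into
  -- column lo, hence be in row r. Column lo-1 would then satisfy the condition for belonging to the
  -- run.
  before-i : ∀ d {y} → suc d ≡ lo → Has a T i d y → ∃ λ w → Has a T (suc i) d w × y < w
  before-i d {y} refl Y with partner d y (free-left-of-c d lo≤c ≤-refl) Y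
  ... | w , W with <-cmp y w
  ... | tri< y<w _ _  = w , W , y<w
  ... | tri≈ _ refl _ = contradiction (trans (sym (proj₂ W)) (proj₂ Y)) 1+n≢n
  ... | tri> _ _ w<y  = contradiction (subst (_< y) w≡r w<y)
                          (left-max d y refl (subst (Has a T (suc i) d) w≡r W) Y)
    where
    y<w : len y < len w
    y<w = free-length d (free-left-of-c d lo≤c ≤-refl) W Y w<y
    w≡r : w ≡ r
    w≡r = unique (1+i-continues-I W Y w<y y<w (≤-<-trans (proj₂ (proj₂ (proj₁ Y))) y<w))
                 (row-r lo ≤-refl lo≤hi)

  before-i-< : ∀ d {y} → suc d ≡ lo → Has a T i d y → y < r
  before-i-< d e Y with before-i d e Y
  ... | w , W , y<w = <-≤-trans y<w (before-1+i d e W)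

  last-i : ∀ {s} → Has a T i hi s → s < r × len s ≤ len r
  last-i S with m≤n⇒m<n∨m≡n c≤hi
  ... | inj₁ c<hi = right-length hi c<hi ≤-refl S
  ... | inj₂ refl = contradiction S (centre-no-i _)

  -- For an i below row r there are two cases. If its row is at most as long as row r, the i+1 of
  -- row r continues and the run would extend. If its row is longer, the i extends left into column
  -- hi, against `last-i`.
  after-i : ∀ {y} → Has a T i (suc hi) y → r ≤ y
  after-i {y} Y with r ≤? y | len y ≤? len r
  ... | yes r≤y | _ = r≤y
  ... | no r≰y | yes l =
    contradiction (≰⇒> r≰y) (right-max y
      (1+i-continues-II (row-r hi lo≤hi ≤-refl) Y (≰⇒> r≰y) l) Y)
  ... | no r≰y | no l =
    contradiction (proj₂ (last-i (i-precedes-I Y (row-r hi lo≤hi ≤-refl) (≰⇒> r≰y) (≰⇒> l)))) l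

  -- An i+1 in row r would have its partner i above it. That i lies in a shorter row, since
  -- otherwise it would extend left into column hi above row r, against `last-i`;
  -- `no-shorter-i-above` then applies.
  after-1+i : ∀ {w} → Has a T (suc i) (suc hi) w → r < w
  after-1+i {w} W = ≤∧≢⇒< (ascending (row-r hi lo≤hi ≤-refl) W)
    (λ e → absurd (subst (Has a T (suc i) (suc hi)) (sym e) W))
    where
    absurd : Has a T (suc i) (suc hi) r → ⊥
    absurd W = no-shorter-i-above (len r) (suc hi) (m≤m+n (len r) (suc hi))
        (≤-trans c≤hi (n≤1+n hi)) (proj₁ next) W Y r<y y<r
      where
      next = free-right hi r c≤hi (free-run-right hi c≤hi ≤-refl) W
      y = proj₁ (proj₂ next)
      Y : Has a T i (suc hi) y
      Y = proj₂ (proj₂ next)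
      r<y : r < y
      r<y = ≤∧≢⇒< (after-i Y) λ e →
        1+n≢n (trans (sym (proj₂ W)) (trans (cong (λ u → val T u (suc hi)) e) (proj₂ Y)))
      y<r : len y < len r
      y<r = ≰⇒> λ r≤y → <⇒≯ (proj₁ (last-i (i-precedes-II Y W r<y r≤y))) r<y

  -- Adjacent columns of which at least one is altered.

  run-i : ∀ d {x} → lo ≤ d → d ≤ hi → Has a T′ i d x → x ≡ r
  run-i d {x} l h (X , e) = unique (X , swap-from-i (swapped x d X l h) e) (row-r d l h)

  run-1+i : ∀ d {x} → lo ≤ d → d ≤ hi → Has a T′ (suc i) d x → Has a T i d x
  run-1+i d {x} l h (X , e) = X , swap-from-1+i (swapped x d X l h) e

  left-out : ∀ d {v x} → d < lo → Has a T′ v d x → Has a T v d x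
  left-out d {x = x} l (X , e) = X , trans (sym (left-same x d X l)) e

  right-out : ∀ d {v x} → hi < d → Has a T′ v d x → Has a T v d x
  right-out d {x = x} h (X , e) = X , trans (sym (right-same x d X h)) e

  -- The conditions that involve two entries in {i, i+1}: non-attacking for each value, and the
  -- cases of `CreatedCoInv`. `no-ascent` concerns `T` and `no-ascent′` the raised filling; together
  -- they make the ascents of the two fillings agree.
  record Compatible (d : ℕ) : Set where
    field
      ascending-i   : ∀ {x y} → Has a T′ i d x → Has a T′ i (suc d) y → x ≤ y
      ascending-1+i : ∀ {x y} → Has a T′ (suc i) d x → Has a T′ (suc i) (suc d) y → x ≤ y
      no-ascent     : ∀ {x} → Has a T i d x → ¬ Has a T (suc i) (suc d) x
      no-ascent′    : ∀ {x} → Has a T′ i d x → ¬ Has a T′ (suc i) (suc d) x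
      kp-I  : ∀ {x s} → Has a T′ (suc i) d x → Has a T′ i d s → x < s → ¬ len s < len x
      kp-II : ∀ {x s} → Has a T′ (suc i) d x → Has a T′ i (suc d) s → s < x → ¬ len s ≤ len x
      qk-I  : ∀ {x s} → Has a T′ i (suc d) x → Has a T′ (suc i) d s → x < s → len s < len x →
              Mid i (val T x d)
      qk-II : ∀ {x s} → Has a T′ i (suc d) x → Has a T′ (suc i) (suc d) s → s < x →
              len s ≤ len x → Mid i (val T x d)

  -- The raised i is in row r and the raised i+1 where `T` has its i: above row r left of the
  -- centre, and in a row no longer than row r right of it.
  kp-I-run : ∀ d {x s} → lo ≤ d → d ≤ hi → Has a T′ (suc i) d x → Has a T′ i d s →
             x < s → ¬ len s < len x
  kp-I-run d l h X S x<s ls with run-i d l h S | run-1+i d l h X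
  ... | refl | X₀ with <-cmp d c
  ... | tri< d<c _ _  = <⇒≯ x<s (proj₁ (left-length d l d<c X₀))
  ... | tri≈ _ refl _ = centre-no-i _ X₀
  ... | tri> _ _ c<d  = <⇒≱ ls (proj₂ (right-length d c<d h X₀))

  first-1+i : ∀ {x} → Has a T′ (suc i) lo x → r < x
  first-1+i X with run-1+i lo ≤-refl lo≤hi X
  ... | X₀ with m≤n⇒m<n∨m≡n lo≤c
  ... | inj₁ lo<c = proj₁ (left-length lo ≤-refl lo<c X₀)
  ... | inj₂ refl = contradiction X₀ (centre-no-i _)

  -- In the unaltered column lo-1, i is below row r and i+1 weakly below it; in the raised column
  -- lo, i is in row r and i+1 above it.
  compatible-left : ∀ d → suc d ≡ lo → Compatible d
  compatible-left d refl = record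
    { ascending-i   = λ X Y → <⇒≤ (subst (_ <_) (sym (i-at Y)) (before-i-< d refl (out X)))
    ; ascending-1+i = λ X Y → ≤-trans (before-1+i d refl (out X)) (<⇒≤ (first-1+i Y))
    ; no-ascent     = λ X Y → <⇒≢ (before-i-< d refl X) (unique Y (row-r lo ≤-refl lo≤hi))
    ; no-ascent′    = λ X Y → <⇒≯ (before-i-< d refl (out X)) (first-1+i Y)
    ; kp-I          = λ X S x<s _ → i-below (out X) (out S) x<s
    ; kp-II         = λ X S s<x _ →
        <⇒≱ (subst (_< _) (i-at S) s<x) (before-1+i d refl (out X))
    ; qk-I          = λ X S x<s _ → contradiction (before-1+i d refl (out S))
        (<⇒≱ (subst (_< _) (i-at X) x<s))
    ; qk-II         = λ X S s<x _ → contradiction (subst (_ <_) (i-at X) s<x)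
        (<⇒≯ (first-1+i S))
    }
    where
    out : ∀ {v x} → Has a T′ v d x → Has a T v d x
    out = left-out d ≤-refl
    i-at : ∀ {x} → Has a T′ i lo x → x ≡ r
    i-at = run-i lo ≤-refl lo≤hi
    i-below : ∀ {x s} → Has a T (suc i) d x → Has a T i d s → ¬ x < s
    i-below X S x<s with before-i d refl S
    ... | w , W , s<w = <⇒≯ x<s (subst (_ <_) (unique W X) s<w)

  -- Row r turns from i+1 to i in both columns, and a raised i+1 sits where `T` has its i, off row
  -- r. The bounds of `left-length` and `right-length` exclude the remaining triples.
  compatible-inside : ∀ d → lo ≤ d → d < hi → Compatible d
  compatible-inside d l h⁺ = record
    { ascending-i   = λ X Y → ≤-reflexive (trans (run-i d l h X) (sym (run-i (suc d) l⁺ h⁺ Y)))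
    ; ascending-1+i = λ X Y → ascending (run-1+i d l h X) (run-1+i (suc d) l⁺ h⁺ Y)
    ; no-ascent     = λ X Y → i-not-r d l h X (unique Y (row-r (suc d) l⁺ h⁺))
    ; no-ascent′    = λ X Y → i-not-r (suc d) l⁺ h⁺ (run-1+i (suc d) l⁺ h⁺ Y) (run-i d l h X)
    ; kp-I          = kp-I-run d l h
    ; kp-II         = kp-II-run
    ; qk-I          = λ X _ _ _ → r-mid X
    ; qk-II         = λ X _ _ _ → r-mid X
    }
    where
    h : d ≤ hi
    h = <⇒≤ h⁺
    l⁺ : lo ≤ suc d
    l⁺ = ≤-trans l (n≤1+n d)
    i-not-r : ∀ e {x} → lo ≤ e → e ≤ hi → Has a T i e x → x ≢ r
    i-not-r e l h (_ , p) refl = 1+n≢n (trans (sym (proj₂ (row-r e l h))) p)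
    r-mid : ∀ {x} → Has a T′ i (suc d) x → Mid i (val T x d)
    r-mid X with run-i (suc d) l⁺ h⁺ X
    ... | refl = inj₂ (proj₂ (row-r d l h))
    kp-II-run : ∀ {x s} → Has a T′ (suc i) d x → Has a T′ i (suc d) s → s < x → ¬ len s ≤ len x
    kp-II-run X S s<x ls with run-i (suc d) l⁺ h⁺ S | run-1+i d l h X
    ... | refl | X₀ with <-cmp d c
    ... | tri< d<c _ _  = <⇒≱ (proj₂ (left-length d l d<c X₀)) ls
    ... | tri≈ _ refl _ = centre-no-i _ X₀
    ... | tri> _ _ c<d  = <⇒≯ s<x (proj₁ (right-length d c<d h X₀))

  -- In the raised column hi, i is in row r and i+1 below it; in the unaltered column hi+1, i is
  -- weakly above row r and i+1 strictly above.
  compatible-right : Compatible hi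
  compatible-right = record
    { ascending-i   = λ X Y → subst (_≤ _) (sym (i-at X)) (after-i (out Y))
    ; ascending-1+i = λ X Y → <⇒≤ (<-trans (proj₁ (last X)) (after-1+i (out Y)))
    ; no-ascent     = λ X Y → <⇒≯ (proj₁ (last-i X)) (after-1+i Y)
    ; no-ascent′    = λ X Y → <⇒≢ (after-1+i (out Y)) (sym (i-at X))
    ; kp-I          = kp-I-run hi lo≤hi ≤-refl
    ; kp-II         = λ X S s<x _ → <⇒≱ (<-trans s<x (proj₁ (last X))) (after-i (out S))
    ; qk-I          = λ X S x<s _ → contradiction (after-i (out X))
        (<⇒≱ (<-trans x<s (proj₁ (last S))))
    -- Both cells of column hi+1 are unaltered, so the triple condition of `T` puts an i at the
    -- remaining cell of the triple.
    ; qk-II         = λ X S s<x ls → inj₁ (proj₂ (i-precedes-II (out X) (out S) s<x ls))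
    }
    where
    out : ∀ {v x} → Has a T′ v (suc hi) x → Has a T v (suc hi) x
    out = right-out (suc hi) ≤-refl
    i-at : ∀ {x} → Has a T′ i hi x → x ≡ r
    i-at = run-i hi lo≤hi ≤-refl
    last : ∀ {x} → Has a T′ (suc i) hi x → x < r × len x ≤ len r
    last X = last-i (run-1+i hi lo≤hi ≤-refl X)

  -- From adjacent columns to the conditions and ascents of the raised filling.

  data Adjacent (d : ℕ) : Set where
    unchanged  : (∀ {x} → InExt a x d → val T′ x d ≡ val T x d) →
                 (∀ {x} → InExt a x (suc d) → val T′ x (suc d) ≡ val T x (suc d)) → Adjacent d
    compatible : Compatible d → Adjacent d

  adjacent : ∀ d → Adjacent d
  adjacent d with <-cmp (suc d) lo | <-cmp d hi
  ... | tri< l _ _ | _            = unchanged (λ X → left-same _ d X (<⇒≤ l))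
                                              (λ X → left-same _ (suc d) X l)
  ... | tri≈ _ e _ | _            = compatible (compatible-left d e)
  ... | tri> _ _ l | tri< h _ _   = compatible (compatible-inside d (s≤s⁻¹ l) h)
  ... | tri> _ _ l | tri≈ _ e _   = compatible (subst Compatible (sym e) compatible-right)
  ... | tri> _ _ l | tri> _ _ h   = unchanged (λ X → right-same _ d X h)
                                              (λ X → right-same _ (suc d) X (m≤n⇒m≤1+n h))

  simᵀ : ∀ {x} d → InExt a x d → Sim i (val T x d) (val T′ x d)
  simᵀ {x} d X with d <? lo | hi <? d
  ... | yes l | _     = ≡-sim (left-same x d X l)
  ... | no _  | yes h = ≡-sim (right-same x d X h)
  ... | no l  | no h  = swap-sim (swapped x d X (≮⇒≥ l) (≮⇒≥ h))

  unmoved : ∀ {v x} d → ¬ Mid i v → Has a T′ v d x → Has a T v d x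
  unmoved {x = x} d ¬m (X , refl) with d <? lo | hi <? d
  ... | yes l | _     = X , sym (left-same x d X l)
  ... | no _  | yes h = X , sym (right-same x d X h)
  ... | no l  | no h  = X , swap-outside (swapped x d X (≮⇒≥ l) (≮⇒≥ h)) ¬m

  unique′ : ∀ {v x y} d → Has a T′ v d x → Has a T′ v d y → x ≡ y
  unique′ {v} d X Y with d <? lo | hi <? d | mid? i v
  ... | yes l | _     | _               = unique (left-out d l X) (left-out d l Y)
  ... | no _  | yes h | _               = unique (right-out d h X) (right-out d h Y)
  ... | no l  | no h  | no ¬m           = unique (unmoved d ¬m X) (unmoved d ¬m Y)
  ... | no l  | no h  | yes (inj₁ refl) = trans (run-i d l′ h′ X) (sym (run-i d l′ h′ Y))
    where l′ = ≮⇒≥ l ; h′ = ≮⇒≥ h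
  ... | no l  | no h  | yes (inj₂ refl) = unique (run-1+i d l′ h′ X) (run-1+i d l′ h′ Y)
    where l′ = ≮⇒≥ l ; h′ = ≮⇒≥ h

  ascending′ : ∀ {v x y} d → Has a T′ v d x → Has a T′ v (suc d) y → x ≤ y
  ascending′ {v} d X Y with adjacent d | mid? i v
  ... | unchanged f g  | _               =
    ascending (proj₁ X , trans (sym (f (proj₁ X))) (proj₂ X))
              (proj₁ Y , trans (sym (g (proj₁ Y))) (proj₂ Y))
  ... | compatible _   | no ¬m           = ascending (unmoved d ¬m X) (unmoved (suc d) ¬m Y)
  ... | compatible C   | yes (inj₁ refl) = Compatible.ascending-i C X Y
  ... | compatible C   | yes (inj₂ refl) = Compatible.ascending-1+i C X Y

  entries′ : 1 ≤ i → Entries a T′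
  entries′ 1≤i x (suc d) X@(p , q , _ , l) =
    sim-bounds 1≤i i<n (simᵀ (suc d) (p , q , l)) (proj₁ H x (suc d) X)
  entries′ _ _ zero (_ , _ , () , _)

  nonAttacking′ : NonAttacking a T′
  nonAttacking′ = (λ x y d X Y ne e → ne (unique′ d (X , e) (Y , refl)))
                , (λ x y d X Y l e → <⇒≱ l (ascending′ d (X , e) (Y , refl)))

  noCoinv′ : NoCoinvTriples a T′
  noCoinv′ = type-I , type-II
    where
    type-I : ∀ x s d → InExt a x d → InExt a x (suc d) → InExt a s d → x < s → len s < len x →
             ¬ CoInv (val T′ x d) (val T′ x (suc d)) (val T′ s d)
    type-I x s d X X⁺ S x<s ls co with adjacent d
    ... | unchanged f g rewrite f X | g X⁺ | f S =
      proj₁ (proj₂ (proj₂ H)) x s d X X⁺ S x<s ls co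
    ... | compatible C with created (simᵀ d X) (simᵀ (suc d) X⁺) (simᵀ d S) co
    ... | old co₀    = proj₁ (proj₂ (proj₂ H)) x s d X X⁺ S x<s ls co₀
    ... | at-pq p q  = Compatible.no-ascent′ C (X , p) (X⁺ , q)
    ... | at-qk q k m = m (Compatible.qk-I C (X⁺ , q) (S , k) x<s ls)
    ... | at-kp k p  = Compatible.kp-I C (X , p) (S , k) x<s ls
    type-II : ∀ x s d → InExt a x d → InExt a x (suc d) → InExt a s (suc d) → s < x →
              len s ≤ len x → ¬ CoInv (val T′ x d) (val T′ x (suc d)) (val T′ s (suc d))
    type-II x s d X X⁺ S s<x ls co with adjacent d
    ... | unchanged f g rewrite f X | g X⁺ | g S =
      proj₂ (proj₂ (proj₂ H)) x s d X X⁺ S s<x ls co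
    ... | compatible C with created (simᵀ d X) (simᵀ (suc d) X⁺) (simᵀ (suc d) S) co
    ... | old co₀    = proj₂ (proj₂ (proj₂ H)) x s d X X⁺ S s<x ls co₀
    ... | at-pq p q  = Compatible.no-ascent′ C (X , p) (X⁺ , q)
    ... | at-qk q k m = m (Compatible.qk-II C (X⁺ , q) (S , k) s<x ls)
    ... | at-kp k p  = Compatible.kp-II C (X , p) (S , k) s<x ls

  sskd′ : 1 ≤ i → SSKD a T′
  sskd′ 1≤i = entries′ 1≤i , nonAttacking′ , noCoinv′

  -- By `sim-<`, a new ascent could only be i followed by i+1, which `no-ascent′` excludes. The
  -- converse exchanges the two fillings.
  ascent⇒ : ∀ {x} d → InExt a x d → InExt a x (suc d) →
            val T′ x d < val T′ x (suc d) → val T x d < val T x (suc d)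
  ascent⇒ d X X⁺ lt with adjacent d
  ... | unchanged f g = subst₂ _<_ (f X) (g X⁺) lt
  ... | compatible C with sim-< (simᵀ d X) (simᵀ (suc d) X⁺) lt
  ... | inj₁ lt₀     = lt₀
  ... | inj₂ (p , q) = contradiction (X⁺ , q) (Compatible.no-ascent′ C (X , p))

  ascent⇐ : ∀ {x} d → InExt a x d → InExt a x (suc d) →
            val T x d < val T x (suc d) → val T′ x d < val T′ x (suc d)
  ascent⇐ d X X⁺ lt with adjacent d
  ... | unchanged f g = subst₂ _<_ (sym (f X)) (sym (g X⁺)) lt
  ... | compatible C with sim-< (sim-sym (simᵀ d X)) (sim-sym (simᵀ (suc d) X⁺)) lt
  ... | inj₁ lt₀     = lt₀
  ... | inj₂ (p , q) = contradiction (X⁺ , q) (Compatible.no-ascent C (X , p))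

-- The major index as a function of the ascents.

all-1-to : ∀ {P : ℕ → Set} n → (∀ x → 1 ≤ x → x ≤ n → P x) → All P (map suc (upTo n))
all-1-to n p = All.map⁺ (All.applyUpTo⁺₁ _ n λ {j} j<n → p (suc j) (s≤s z≤n) j<n)

maj-cong : ∀ {n} (a : Vec ℕ n) (T T′ : Filling) →
  (∀ {x} d → InExt a x (suc d) → InExt a x (suc (suc d)) →
     T′ x (suc d) < T′ x (suc (suc d)) → T x (suc d) < T x (suc (suc d))) →
  (∀ {x} d → InExt a x (suc d) → InExt a x (suc (suc d)) →
     T x (suc d) < T x (suc (suc d)) → T′ x (suc d) < T′ x (suc (suc d))) →
  maj a T′ ≡ maj a T
maj-cong {n} a T T′ to from =
  cong sum (map-cong-local (all-1-to n λ x p q →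
    cong sum (map-cong-local (all-1-to (rowLen a x ∸ 1) λ
      { (suc d) _ l → cong (if_then rowLen a x ∸ suc d else 0)
          -- The Boolean test `_<ᵇ_` is the `does` of `_<?_`, so equivalent ascents give equal
          -- summands.
          (does-⇔ (mk⇔ (to d (p , q , shorter x l) (p , q , longer x l))
                        (from d (p , q , shorter x l) (p , q , longer x l)))
                  (T′ x (suc d) <? T′ x (suc (suc d))) (T x (suc d) <? T x (suc (suc d)))) }))))
  where
  longer : ∀ x {d} → suc d ≤ rowLen a x ∸ 1 → suc (suc d) ≤ rowLen a x
  longer x l with rowLen a x
  longer x () | zero
  longer x l  | suc _ = s≤s l
  shorter : ∀ x {d} → suc d ≤ rowLen a x ∸ 1 → suc d ≤ rowLen a x
  shorter x l = ≤-trans l (m∸n≤m (rowLen a x) 1)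

-- Row lengths, and Boolean searches read as propositions.

rowLen≤maxLen : ∀ {n} (a : Vec ℕ n) x → rowLen a x ≤ maxLen a
rowLen≤maxLen []       x             = z≤n
rowLen≤maxLen (y ∷ ys) zero          = z≤n
rowLen≤maxLen (y ∷ ys) (suc zero)    = m≤m⊔n y (maxLen ys)
rowLen≤maxLen (y ∷ ys) (suc (suc x)) = ≤-trans (rowLen≤maxLen ys (suc x)) (m≤n⊔m y (maxLen ys))

module _ {A P : Set} where

  if-yes : (P? : Dec P) {x y : A} → P → (if does P? then x else y) ≡ x
  if-yes (yes _) _ = refl
  if-yes (no ¬p) p = contradiction p ¬p

  if-no : (P? : Dec P) {x y : A} → ¬ P → (if does P? then x else y) ≡ y
  if-no (yes p) ¬p = contradiction p ¬p
  if-no (no _)  _  = refl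

  if-just : (P? : Dec P) {m : Maybe A} {x : A} →
            (if does P? then m else nothing) ≡ just x → P × m ≡ just x
  if-just (yes p) e  = p , e
  if-just (no _)  ()

  if-nothing : (P? : Dec P) {m : Maybe A} →
               (if does P? then m else nothing) ≡ nothing → P → m ≡ nothing
  if-nothing (yes _) e _ = e
  if-nothing (no ¬p) _ p = contradiction p ¬p

module _ {P : ℕ → Set} (P? : ∀ x → Dec (P x)) where

  findFirst-just : ∀ xs {x} → findFirst (λ y → does (P? y)) xs ≡ just x → P x
  findFirst-just (y ∷ ys) e with P? y
  findFirst-just (y ∷ ys) refl | yes p = p
  findFirst-just (y ∷ ys) e    | no _  = findFirst-just ys e

  findFirst-nothing : ∀ xs → findFirst (λ y → does (P? y)) xs ≡ nothing → All (¬_ ∘ P) xs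
  findFirst-nothing []       _ = []
  findFirst-nothing (y ∷ ys) e with P? y
  findFirst-nothing (y ∷ ys) () | yes _
  findFirst-nothing (y ∷ ys) e  | no ¬p = ¬p ∷ findFirst-nothing ys e

lookup-1-to : ∀ {P : ℕ → Set} n → All P (map suc (upTo n)) → ∀ x → 1 ≤ x → x ≤ n → P x
lookup-1-to n ps zero    () _
lookup-1-to n ps (suc j) _ j<n = All.applyUpTo⁻ _ n (All.map⁻ ps) j<n

-- The column searched is d+1, so it lies outside the basement and `val T` computes to `T`.
module Search {n} (a : Vec ℕ n) (T : Filling) (d : ℕ) where

  -- Nested exactly as in `inDiagᵇ`, so that its `does` computes to the Boolean test of the
  -- searches.
  cell? : ∀ x v → Dec (InDiag a x (suc d) × T x (suc d) ≡ v)
  cell? x v = ((1 ≤? x) ×-dec ((x ≤? n) ×-dec ((1 ≤? suc d) ×-dec (suc d ≤? rowLen a x))))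
              ×-dec (T x (suc d) ≟ v)

  to-Has : ∀ {x v} → InDiag a x (suc d) × T x (suc d) ≡ v → Has a T v (suc d) x
  to-Has ((p , q , _ , l) , e) = (p , q , l) , e

  from-Has : ∀ {x v} → Has a T v (suc d) x → InDiag a x (suc d) × T x (suc d) ≡ v
  from-Has ((p , q , l) , e) = (p , q , s≤s z≤n , l) , e

  module _ {P : ℕ → Set} (P? : ∀ x → Dec (P x)) (v : ℕ) where
    private
      both? : ∀ x → Dec (P x × InDiag a x (suc d) × T x (suc d) ≡ v)
      both? x = P? x ×-dec cell? x v

    search-just : ∀ {x} → findFirst (λ y → does (both? y)) (map suc (upTo n)) ≡ just x →
                  Has a T v (suc d) x × P x
    search-just e with findFirst-just both? (map suc (upTo n)) e
    ... | p , h = to-Has h , p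

    search-nothing : ∀ {x} → findFirst (λ y → does (both? y)) (map suc (upTo n)) ≡ nothing →
                     Has a T v (suc d) x → ¬ P x
    search-nothing {x} e h@((p , q , _) , _) px =
      lookup-1-to n (findFirst-nothing both? (map suc (upTo n)) e) x p q (px , from-Has h)

  rowWith-just : ∀ {v x} → rowWith a T (suc d) v ≡ just x → Has a T v (suc d) x
  rowWith-just {v} e = proj₁ (search-just {P = λ _ → ⊤} (λ _ → yes tt) v e)

  rowWith-nothing : ∀ {v x} → rowWith a T (suc d) v ≡ nothing → ¬ Has a T v (suc d) x
  rowWith-nothing {v} e h = search-nothing {P = λ _ → ⊤} (λ _ → yes tt) v e h tt

  found : ∀ {v} → isJust (rowWith a T (suc d) v) ≡ true → ∃ (Has a T v (suc d))
  found {v} e with rowWith a T (suc d) v in eq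
  found e  | just x = x , rowWith-just eq
  found () | nothing

  missing : ∀ {v x} → isJust (rowWith a T (suc d) v) ≡ false → ¬ Has a T v (suc d) x
  missing {v} e with rowWith a T (suc d) v in eq
  missing () | just _
  missing e  | nothing = rowWith-nothing eq

  module _ (i r : ℕ) where
    -- `condL` and `condR` are the same for every centre column, so the instance at 0 serves all of
    -- them.
    open Raise a T i r 0 using (condL; condR)

    condL-just : ∀ {s} → condL (suc d) ≡ just s →
                 Has a T (suc i) (suc d) r × Has a T i (suc d) s × r < s
    condL-just e with if-just (cell? r (suc i)) e
    ... | h , e′ = to-Has h , search-just (r <?_) i e′

    condL-nothing : ∀ {s} → condL (suc d) ≡ nothing → Has a T (suc i) (suc d) r →
                    Has a T i (suc d) s → ¬ r < s
    condL-nothing e h = search-nothing (r <?_) i (if-nothing (cell? r (suc i)) e (from-Has h))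

    condR-just : ∀ {s} → condR (suc d) ≡ just s →
                 Has a T (suc i) (suc d) r × Has a T i (suc d) s × s < r
    condR-just e with if-just (cell? r (suc i)) e
    ... | h , e′ = to-Has h , search-just (_<? r) i e′

    condR-nothing : ∀ {s} → condR (suc d) ≡ nothing → Has a T (suc i) (suc d) r →
                    Has a T i (suc d) s → ¬ s < r
    condR-nothing e h = search-nothing (_<? r) i (if-nothing (cell? r (suc i)) e (from-Has h))

-- Bracket matching of the column word.

data ColumnView {n} (a : Vec ℕ n) (T : Filling) (i d : ℕ) : Sym → Set where
  only-i   : ∀ {x} → Has a T i d x → (∀ y → ¬ Has a T (suc i) d y) → ColumnView a T i d opener
  only-1+i : ∀ {y} → Has a T (suc i) d y → (∀ x → ¬ Has a T i d x) → ColumnView a T i d closer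
  both     : ∀ {x y} → Has a T i d x → Has a T (suc i) d y → ColumnView a T i d neutral
  none     : (∀ x → ¬ Has a T i d x) → (∀ y → ¬ Has a T (suc i) d y) → ColumnView a T i d neutral

columnView : ∀ {n} (a : Vec ℕ n) (T : Filling) (i d : ℕ) →
             ColumnView a T i (suc d) (colSym a T i (suc d))
columnView a T i d
  with isJust (rowWith a T (suc d) i) in e | isJust (rowWith a T (suc d) (suc i)) in e′
... | true  | false = only-i (proj₂ (Search.found a T d e)) (λ _ → Search.missing a T d e′)
... | false | true  = only-1+i (proj₂ (Search.found a T d e′)) (λ _ → Search.missing a T d e)
... | true  | true  = both (proj₂ (Search.found a T d e)) (proj₂ (Search.found a T d e′))
... | false | false = none (λ _ → Search.missing a T d e) (λ _ → Search.missing a T d e′)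

-- `pred` covers both kinds of closer: one that pairs lowers the count of waiting openers, an
-- unpaired one leaves it at 0.
step : ℕ → Sym → ℕ
step k opener  = suc k
step k closer  = pred k
step k neutral = k

-- The columns s+1, ..., s+l; the free starting point lets the induction over the scan begin
-- anywhere.
columns : ℕ → ℕ → List ℕ
columns s zero    = []
columns s (suc l) = suc s ∷ columns (suc s) l

map-suc-applyUpTo : ∀ (f : ℕ → ℕ) l s → (∀ k → f k ≡ s + k) →
                    map suc (applyUpTo f l) ≡ columns s l
map-suc-applyUpTo f zero    s _ = refl
map-suc-applyUpTo f (suc l) s h =
  cong₂ _∷_ (cong suc (trans (h 0) (+-identityʳ s)))
            (map-suc-applyUpTo (λ k → f (suc k)) l (suc s) λ k → trans (h (suc k)) (+-suc s k))

module Scan (sym-at : ℕ → Sym) where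

  depth : ℕ → ℕ
  depth zero    = 0
  depth (suc d) = step (depth d) (sym-at (suc d))

  -- Indexed by the preceding column: the unpaired i+1 is in column d+1, with no i waiting after
  -- column d.
  Unpaired : ℕ → Set
  Unpaired d = depth d ≡ 0 × sym-at (suc d) ≡ closer

  NoneIn : ℕ → ℕ → Set
  NoneIn s t = ∀ d → s ≤ d → d < t → ¬ Unpaired d

  LastUnpaired : ℕ → ℕ → Set
  LastUnpaired c t = ∃ λ b → c ≡ suc b × Unpaired b × NoneIn (suc b) t

  last-unpaired-at : ∀ {b t} → LastUnpaired (suc b) t → Unpaired b × NoneIn (suc b) t
  last-unpaired-at (_ , refl , u , none-in) = u , none-in

  -- The scan invariant for columns s+1, ..., t: either the earlier candidate survives, as nothing
  -- there is unpaired, or c is the last unpaired column up to t.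
  ScanResult : Maybe ℕ → ℕ → ℕ → ℕ → Set
  ScanResult best c s t = (best ≡ just c × NoneIn s t) ⊎ LastUnpaired c t

  skip : ∀ {best c s t} → ¬ Unpaired s → ScanResult best c (suc s) t → ScanResult best c s t
  skip ¬u (inj₂ z)       = inj₂ z
  skip {s = s} {t} ¬u (inj₁ (p , q)) = inj₁ (p , none-in)
    where
    none-in : NoneIn s t
    none-in d s≤d d<t with m≤n⇒m<n∨m≡n s≤d
    ... | inj₁ s<d  = q d s<d d<t
    ... | inj₂ refl = ¬u

  scan-spec : ∀ l s k best {c} → depth s ≡ k →
    scan k best (map (λ d → d , sym-at d) (columns s l)) ≡ just c →
    ScanResult best c s (s + l)
  scan-spec zero s k best ek e =
    inj₁ (e , λ d p q → contradiction (subst (d <_) (+-identityʳ s) q) (≤⇒≯ p))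
  scan-spec (suc l) s k best {c} ek e rewrite +-suc s l with sym-at (suc s) in eq | k
  ... | opener  | k₀     = skip (λ (_ , u) → contradiction (trans (sym eq) u) λ ())
                             (scan-spec l (suc s) (suc k₀) best (cong₂ step ek eq) e)
  ... | neutral | k₀     = skip (λ (_ , u) → contradiction (trans (sym eq) u) λ ())
                             (scan-spec l (suc s) k₀ best (cong₂ step ek eq) e)
  ... | closer  | suc k₀ = skip (λ (u , _) → contradiction (trans (sym ek) u) λ ())
                             (scan-spec l (suc s) k₀ best (cong₂ step ek eq) e)
  ... | closer  | zero with scan-spec l (suc s) zero (just (suc s)) (cong₂ step ek eq) e
  ...   | inj₁ (refl , q) = inj₂ (s , refl , (ek , eq) , q)
  ...   | inj₂ z          = inj₂ z

rightmostUnpaired-spec : ∀ {n} (a : Vec ℕ n) (T : Filling) (i : ℕ) {c} →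
  rightmostUnpaired a T i ≡ just c → Scan.LastUnpaired (colSym a T i) c (maxLen a)
rightmostUnpaired-spec a T i e
  rewrite map-suc-applyUpTo (λ k → k) (maxLen a) 0 (λ _ → refl)
  with Scan.scan-spec (colSym a T i) (maxLen a) 0 0 nothing refl e
... | inj₂ z = z

m∸n≤o⇒m≤n+o : ∀ m n {o} → m ∸ n ≤ o → m ≤ n + o
m∸n≤o⇒m≤n+o m n le = ≤-trans (m≤n+m∸n m n) (+-monoʳ-≤ n le)

-- Extent of the runs on both sides of the centre.

module Runs {n} (a : Vec ℕ n) (T : Filling) (i r c : ℕ) where
  open Raise a T i r c using (condL; condR; leftLen; rightLen)

  leftLen≤ : ∀ m → leftLen m ≤ m
  leftLen≤ zero = z≤n
  leftLen≤ (suc m) with isJust (condL (suc m))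
  ... | true  = s≤s (leftLen≤ m)
  ... | false = z≤n

  -- The hypothesis m < d+1 + `leftLen m` places column d+1 among the last `leftLen m` of the
  -- columns 1, ..., m; the sum avoids truncated subtraction.
  leftLen-just : ∀ m d → suc d ≤ m → m < suc d + leftLen m → ∃ λ s → condL (suc d) ≡ just s
  leftLen-just (suc m) d d≤m m< with condL (suc m) in e | m≤n⇒m<n∨m≡n d≤m
  ... | nothing | _         = contradiction (subst (suc m <_) (+-identityʳ (suc d)) m<) (≤⇒≯ d≤m)
  ... | just s  | inj₂ refl = s , e
  ... | just _  | inj₁ d<m  =
    leftLen-just m d (s≤s⁻¹ d<m) (s≤s⁻¹ (subst (suc m <_) (+-suc (suc d) (leftLen m)) m<))

  leftLen-stop : ∀ m d → suc d + leftLen m ≡ m → condL (suc d) ≡ nothing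
  leftLen-stop (suc m) d e with condL (suc m) in eq
  ... | just _  = leftLen-stop m d (suc-injective (trans (sym (+-suc (suc d) (leftLen m))) e))
  ... | nothing = subst (λ u → condL u ≡ nothing) (trans (sym e) (+-identityʳ (suc d))) eq

  rightLen-just : ∀ f s d → s ≤ d → d < s + rightLen f s → ∃ λ x → condR d ≡ just x
  rightLen-just zero s d s≤d d< = contradiction (subst (d <_) (+-identityʳ s) d<) (≤⇒≯ s≤d)
  rightLen-just (suc f) s d s≤d d< with condR s in e | m≤n⇒m<n∨m≡n s≤d
  ... | nothing | _         = contradiction (subst (d <_) (+-identityʳ s) d<) (≤⇒≯ s≤d)
  ... | just x  | inj₂ refl = x , e
  ... | just _  | inj₁ s<d  =
    rightLen-just f (suc s) d s<d (subst (d <_) (+-suc s (rightLen f (suc s))) d<)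

  rightLen-stop : ∀ f s → rightLen f s ≡ f ⊎ condR (s + rightLen f s) ≡ nothing
  rightLen-stop zero s = inj₁ refl
  rightLen-stop (suc f) s with condR s in e
  ... | nothing = inj₂ (trans (cong condR (+-identityʳ s)) e)
  ... | just _ with rightLen-stop f (suc s)
  ...   | inj₁ p = inj₁ (cong suc p)
  ...   | inj₂ q = inj₂ (trans (cong condR (+-suc s (rightLen f (suc s)))) q)

-- The computed filling meets the abstract description of raising.

module Extraction {n} (a : Vec ℕ n) (i : ℕ) (T : Filling) (H : SSKD a T) (r b : ℕ)
                  (last-unpaired : Scan.LastUnpaired (colSym a T i) (suc b) (maxLen a))
                  (centre : Has a T (suc i) (suc b) r) where
  open Columns a T H
  open Scan (colSym a T i)
  open Raise a T i r (suc b) using (condL; condR; leftLen; rightLen; result; swapAt)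
    renaming (L to ℓ; R to ρ)
  open Runs a T i r (suc b)

  lo hi : ℕ
  lo = suc b ∸ ℓ
  hi = suc b + ρ

  Free : ℕ → Set
  Free d = depth d ≡ 0

  unpaired : Unpaired b
  unpaired = proj₁ (last-unpaired-at last-unpaired)

  paired-after : ∀ {d} → suc b ≤ d → d < maxLen a → ¬ Unpaired d
  paired-after = proj₂ (last-unpaired-at last-unpaired) _

  1≤lo : 1 ≤ lo
  1≤lo = m<n⇒0<n∸m (s≤s (leftLen≤ b))

  lo+ℓ : lo + ℓ ≡ suc b
  lo+ℓ = m∸n+n≡m (≤-trans (leftLen≤ b) (n≤1+n b))

  -- A column with i alone is an opener and would leave positive depth. So the column also has an
  -- i+1, is neutral, and keeps the depth.
  free-left : ∀ d x → Free (suc d) → Has a T i (suc d) x → Free d × ∃ (Has a T (suc i) (suc d))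
  free-left d x f X with colSym a T i (suc d) | columnView a T i d
  free-left d x () X | _ | only-i _ _
  ... | _ | only-1+i _ ¬i = contradiction X (¬i x)
  ... | _ | both _ Y      = f , _ , Y
  ... | _ | none ¬i _     = contradiction X (¬i x)

  -- An i+1 alone in its column at depth 0 would be unpaired to the right of the rightmost unpaired
  -- one.
  free-right : ∀ d x → suc b ≤ d → Free d → Has a T (suc i) (suc d) x →
               Free (suc d) × ∃ (Has a T i (suc d))
  free-right d x b<d f X with colSym a T i (suc d) in e | columnView a T i d
  ... | _ | only-i _ ¬1+i   = contradiction X (¬1+i x)
  ... | _ | only-1+i _ _    =
    contradiction (f , e) (paired-after b<d (≤-trans (proj₂ (proj₂ (proj₁ X))) (rowLen≤maxLen a x)))
  ... | _ | both Y _        = f , _ , Y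
  ... | _ | none _ ¬1+i     = contradiction X (¬1+i x)

  free-at : Free (suc b)
  free-at = cong₂ step (proj₁ unpaired) (proj₂ unpaired)

  centre-no-i : ∀ x → ¬ Has a T i (suc b) x
  centre-no-i x X with colSym a T i (suc b) | proj₂ unpaired | columnView a T i b
  ... | _ | refl | only-1+i _ ¬i = ¬i x X

  condL-run : ∀ d → lo ≤ suc d → suc d < suc b → ∃ λ s → condL (suc d) ≡ just s
  condL-run d l d<b = leftLen-just b d (s≤s⁻¹ d<b)
    (subst (_≤ suc d + ℓ) lo+ℓ (+-monoˡ-≤ ℓ l))

  condR-run : ∀ d → suc b < d → d ≤ hi → ∃ λ s → condR d ≡ just s
  condR-run d b<d h = rightLen-just (maxLen a) (suc (suc b)) d b<d (s≤s h)

  left : ∀ d → lo ≤ d → d < suc b → Has a T (suc i) d r × ∃ λ s → Has a T i d s × r < s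
  left zero    l _ = contradiction (≤-trans 1≤lo l) λ ()
  left (suc d) l d<b with condL-run d l d<b
  ... | s , e with Search.condL-just a T d i r e
  ... | R , S = R , s , S

  right : ∀ d → suc b < d → d ≤ hi → Has a T (suc i) d r × ∃ λ s → Has a T i d s × s < r
  right (suc d) b<d h with condR-run (suc d) b<d h
  ... | s , e with Search.condR-just a T d i r e
  ... | R , S = R , s , S

  left-max : 1 ≤ i → ∀ d s → suc d ≡ lo → Has a T (suc i) d r → Has a T i d s → ¬ r < s
  -- For lo = 1 the neighbour is the basement, where i lies in row i, below the i+1 of row i+1.
  left-max _ zero    s _ (_ , refl) (_ , refl) r<s = <⇒≯ r<s (n<1+n _)
  left-max _ (suc d) s e = Search.condL-nothing a T d i r
    (leftLen-stop b d (suc-injective (trans (cong (_+ ℓ) e) lo+ℓ)))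

  right-max : ∀ s → Has a T (suc i) (suc hi) r → Has a T i (suc hi) s → ¬ s < r
  right-max s R with rightLen-stop (maxLen a) (suc (suc b))
  ... | inj₂ e = Search.condR-nothing a T hi i r e R
  -- If the fuel is exhausted, hi is at least `maxLen a`, and no row reaches column hi+1.
  ... | inj₁ e = contradiction (≤-trans (proj₂ (proj₂ (proj₁ R))) (rowLen≤maxLen a r))
    (<⇒≱ (s≤s (subst (_≤ hi) e (m≤n+m ρ (suc b)))))

  inL? : ∀ d → Dec (d < suc b × suc b ∸ d ≤ ℓ)
  inL? d = (d <? suc b) ×-dec (suc b ∸ d ≤? ℓ)

  inR? : ∀ d → Dec (suc b < d × d ∸ suc b ≤ ρ)
  inR? d = (suc b <? d) ×-dec (d ∸ suc b ≤? ρ)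

  result-centre : ∀ x → result x (suc b) ≡ (if x ≡ᵇ r then i else T x (suc b))
  result-centre x = if-yes (suc b ≟ suc b) refl

  result-left : ∀ x d → lo ≤ d → d < suc b → result x d ≡ swapAt (condL d) x d
  result-left x d l d<b = trans (if-no (d ≟ suc b) (<⇒≢ d<b))
    (if-yes (inL? d)
      (d<b , m≤n+o⇒m∸n≤o (suc b) d (subst (_≤ d + ℓ) lo+ℓ (+-monoˡ-≤ ℓ l))))

  result-right : ∀ x d → suc b < d → d ≤ hi → result x d ≡ swapAt (condR d) x d
  result-right x d b<d h = trans (if-no (d ≟ suc b) (<⇒≢ b<d ∘ sym))
    (trans (if-no (inL? d) (λ (d<b , _) → <⇒≯ b<d d<b))
           (if-yes (inR? d) (b<d , m≤n+o⇒m∸n≤o d (suc b) h)))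

  result-outside : ∀ x d → d < lo ⊎ hi < d → result x d ≡ T x d
  result-outside x d out =
    trans (if-no (d ≟ suc b) (≢b out))
      (trans (if-no (inL? d) (¬inL out)) (if-no (inR? d) (¬inR out)))
    where
    ≢b : d < lo ⊎ hi < d → d ≢ suc b
    ≢b (inj₁ l) refl = <⇒≱ l (m∸n≤m (suc b) ℓ)
    ≢b (inj₂ h) refl = <⇒≱ h (m≤m+n (suc b) ρ)
    ¬inL : d < lo ⊎ hi < d → ¬ (d < suc b × suc b ∸ d ≤ ℓ)
    ¬inL (inj₁ l) (_ , q) = <⇒≱ l (m≤n+o⇒m∸n≤o (suc b) ℓ
      (subst (suc b ≤_) (+-comm d ℓ) (m∸n≤o⇒m≤n+o (suc b) d q)))
    ¬inL (inj₂ h) (p , _) = <⇒≱ (<-trans h p) (m≤m+n (suc b) ρ)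
    ¬inR : d < lo ⊎ hi < d → ¬ (suc b < d × d ∸ suc b ≤ ρ)
    ¬inR (inj₁ l) (p , _) = <⇒≱ (<-trans p l) (m∸n≤m (suc b) ℓ)
    ¬inR (inj₂ h) (_ , q) = <⇒≱ h (m∸n≤o⇒m≤n+o d (suc b) q)

  -- Altering a single cell is the transposition on the whole column, since row r holds its only i+1
  -- and there is no i. In `swap-two`, rows r and s hold the only i+1 and i.
  swap-one : ∀ {d x} → Has a T (suc i) (suc d) r → (∀ y → ¬ Has a T i (suc d) y) →
             InExt a x (suc d) → Swap i (T x (suc d)) (if x ≡ᵇ r then i else T x (suc d))
  swap-one {d} {x} R ¬i X with x ≟ r
  ... | yes refl = subst₂ (Swap i) (sym (proj₂ R)) (sym (if-yes (x ≟ x) refl)) down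
  ... | no x≢r   = subst (Swap i _) (sym (if-no (x ≟ r) x≢r))
    (fix [ (λ e → ¬i x (X , e)) , (λ e → x≢r (unique (X , e) R)) ]′)

  swap-two : ∀ {d x s} → Has a T (suc i) (suc d) r → Has a T i (suc d) s →
             InExt a x (suc d) → Swap i (T x (suc d)) (swapAt (just s) x (suc d))
  swap-two {d} {x} {s} R S X with x ≟ r | x ≟ s
  ... | yes refl | _        =
    subst₂ (Swap i) (sym (proj₂ R)) (sym (if-yes (x ≟ x) refl)) down
  ... | no x≢r   | yes refl =
    subst₂ (Swap i) (sym (proj₂ S)) (sym (trans (if-no (x ≟ r) x≢r) (if-yes (x ≟ x) refl))) up
  ... | no x≢r   | no x≢s   =
    subst (Swap i _) (sym (trans (if-no (x ≟ r) x≢r) (if-no (x ≟ s) x≢s)))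
      (fix [ (λ e → x≢s (unique (X , e) S)) , (λ e → x≢r (unique (X , e) R)) ]′)

  swapped : ∀ x d → InExt a x d → lo ≤ d → d ≤ hi → Swap i (val T x d) (val result x d)
  swapped x zero    X l h = contradiction (≤-trans 1≤lo l) λ ()
  swapped x (suc d) X l h with <-cmp (suc d) (suc b)
  ... | tri≈ _ refl _ = subst (Swap i _) (sym (result-centre x)) (swap-one centre centre-no-i X)
  ... | tri< d<b _ _ with condL-run d l d<b
  ...   | s , e with Search.condL-just a T d i r e
  ...     | R , S , _ = subst (Swap i _)
    (sym (trans (result-left x (suc d) l d<b) (cong (λ m → swapAt m x (suc d)) e))) (swap-two R S X)
  swapped x (suc d) X l h | tri> _ _ b<d with condR-run (suc d) b<d h
  ...   | s , e with Search.condR-just a T d i r e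
  ...     | R , S , _ = subst (Swap i _)
    (sym (trans (result-right x (suc d) b<d h) (cong (λ m → swapAt m x (suc d)) e))) (swap-two R S X)

  same-outside : ∀ x d → d < lo ⊎ hi < d → val result x d ≡ val T x d
  same-outside x zero    _ = refl
  same-outside x (suc d)   = result-outside x (suc d)

  isRaising : 1 ≤ i → IsRaising a i T result Free r (suc b) lo hi
  isRaising 1≤i = record
    { 1≤lo        = 1≤lo
    ; lo≤c        = m∸n≤m (suc b) ℓ
    ; c≤hi        = m≤m+n (suc b) ρ
    ; free-before = λ { _ refl → proj₁ unpaired }
    ; free-at     = free-at
    ; free-left   = free-left
    ; free-right  = free-right
    ; centre      = centre
    ; centre-no-i = centre-no-i
    ; left        = left
    ; right       = right
    ; left-max    = left-max 1≤i
    ; right-max   = right-max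
    ; swapped     = swapped
    ; left-same   = λ x d _ l → same-outside x d (inj₁ l)
    ; right-same  = λ x d _ h → same-outside x d (inj₂ h)
    }

-- From the value of `raise` to preservation of the conditions and of `maj`.

raise-inverse : ∀ {n} (a : Vec ℕ n) (i : ℕ) (T : Filling) {T′} → raise a i T ≡ just T′ →
  ∃ λ c → ∃ λ r → rightmostUnpaired a T i ≡ just c × rowWith a T c (suc i) ≡ just r ×
    T′ ≡ Raise.result a T i r c
raise-inverse a i T e with rightmostUnpaired a T i
raise-inverse a i T () | nothing
... | just c with rowWith a T c (suc i) in e′
raise-inverse a i T () | just c | nothing
raise-inverse a i T refl | just c | just r = c , r , refl , e′ , refl

theorem5p11 : (n : ℕ) (a : Vec ℕ n) (i : ℕ) → 1 ≤ i → i < n →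
    (T : Filling) → SSKD a T →
    (T′ : Filling) → raise a i T ≡ just T′ →
    SSKD a T′ × maj a T′ ≡ maj a T
theorem5p11 n a i 1≤i i<n T H T′ e with raise-inverse a i T e
... | c , r , unpaired , row , refl with rightmostUnpaired-spec a T i unpaired
... | z@(b , refl , _) =
  P.sskd′ 1≤i , maj-cong a T T₁ (λ d → P.ascent⇒ (suc d)) (λ d → P.ascent⇐ (suc d))
  where
  T₁ : Filling
  T₁ = Raise.result a T i r (suc b)
  module P = Preservation a i i<n T T₁ H
    (Extraction.isRaising a i T H r b z (Search.rowWith-just a T b row) 1≤i)
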